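{- Every matrix $A\in M(3,\mathbb{Z})$ whose norm is less than or equal to $6$ is of Frobenius type.
   Context: $M(k,\mathbb{Z})$ denotes the set of $k\times k$ matrices with integer entries whose characteristic polynomial is irreducible over $\mathbb{Q}$. The norm of a matrix is the sum of the absolute values of all its entries. For integers $a_1,\ldots,a_k$, the Frobenius matrix $M_{a_1,\ldots,a_k}$ is the $k\times k$ matrix obtained from the $(k-1)\times(k-1)$ identity matrix by adding a column of zeroes on the left and the row $(a_k,\ldots,a_1)$ at the bottom; that is, its $(i,i+1)$ entries equal $1$ for $1\le i\le k-1$, its last row is $(a_k,a_{k-1},\ldots,a_1)$, and all other entries are $0$. A matrix $A\in M(k,\mathbb{Z})$ is said to be of Frobenius type if there exist integers $a_1,\ldots,a_k$ and a matrix $X\in SL(k,\mathbb{Z})$ such that $XAX^{ -1}$ commutes with $M_{a_1,\ldots,a_k}$. -}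

module Defs where

open import Algebra.Bundles.Raw using (RawRing)
import Algebra.Definitions.RawSemiring as RawSemiringDefinitions
open import Data.Bool.Base using (if_then_else_)
open import Data.Fin.Base using (Fin; zero; toℕ)
open import Data.Fin.Properties using (_≟_)
open import Data.Fin.Relation.Unary.Top using (view; ‵fromℕ; ‵inject₁)
open import Data.Integer.Base as ℤ using (ℤ)
open import Data.List.Base as List using (List; []; _∷_)
open import Data.Nat.Base as ℕ using (ℕ; zero; suc)
open import Data.Product.Base using (_×_; ∃-syntax)
open import Data.Rational.Base as ℚ using (ℚ)
open import Data.Rational.Literals using (fromℤ)
open import Data.Vec.Functional as Vector using (Vector)
open import Level using (0ℓ)
open import Relation.Binary.PropositionalEquality.Core using (_≡_)
open import Relation.Nullary.Decidable.Core using (does)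
open import Relation.Unary using (Pred; _∈_)

module SquareMatrix {c ℓ} (R : RawRing c ℓ) where
  open RawRing R
  open RawSemiringDefinitions rawSemiring using (sum; _^_)

  Matrix : ℕ → Set c
  Matrix n = Vector (Vector Carrier n) n

  infix 4 _≈ᴹ_
  _≈ᴹ_ : ∀ {n} → Matrix n → Matrix n → Set ℓ
  A ≈ᴹ B = ∀ i j → A i j ≈ B i j

  1ᴹ : ∀ {n} → Matrix n
  1ᴹ i j = if does (i ≟ j) then 1# else 0#

  infixl 7 _*ᴹ_
  _*ᴹ_ : ∀ {n} → Matrix n → Matrix n → Matrix n
  (A *ᴹ B) i j = sum (λ l → A i l * B l j)

  minor : ∀ {n} → Fin (suc n) → Fin (suc n) → Matrix (suc n) → Matrix n
  minor i j A = Vector.map (λ row → Vector.removeAt row j) (Vector.removeAt A i)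

  -- Laplace expansion along the first row.
  det : ∀ {n} → Matrix n → Carrier
  det {zero}  A = 1#
  det {suc n} A =
    sum (λ j → (- 1#) ^ toℕ j * (A zero j * det (minor zero j A)))

-- Univariate polynomials as coefficient lists, constant term first.  Trailing
-- zeros are allowed, so equality of polynomials is equality of coefficients.
module Polynomial {c ℓ} (R : RawRing c ℓ) where
  open RawRing R

  Poly : Set c
  Poly = List Carrier

  coeff : Poly → ℕ → Carrier
  coeff []      _       = 0#
  coeff (a ∷ p) zero    = a
  coeff (a ∷ p) (suc n) = coeff p n

  infix 4 _≈ᴾ_
  _≈ᴾ_ : Poly → Poly → Set ℓ
  p ≈ᴾ q = ∀ n → coeff p n ≈ coeff q n

  infixl 6 _+ᴾ_
  _+ᴾ_ : Poly → Poly → Poly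
  []      +ᴾ q       = q
  (a ∷ p) +ᴾ []      = a ∷ p
  (a ∷ p) +ᴾ (b ∷ q) = (a + b) ∷ (p +ᴾ q)

  infixl 7 _*ᴾ_
  _*ᴾ_ : Poly → Poly → Poly
  []      *ᴾ q = []
  (a ∷ p) *ᴾ q = List.map (a *_) q +ᴾ (0# ∷ (p *ᴾ q))

  polyRawRing : RawRing c ℓ
  polyRawRing = record
    { Carrier = Poly
    ; _≈_     = _≈ᴾ_
    ; _+_     = _+ᴾ_
    ; _*_     = _*ᴾ_
    ; -_      = List.map (-_)
    ; 0#      = []
    ; 1#      = 1# ∷ []
    }

  constant : Carrier → Poly
  constant a = a ∷ []

  indeterminate : Poly
  indeterminate = 0# ∷ 1# ∷ []

open SquareMatrix ℤ.+-*-rawRing public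
open Polynomial ℤ.+-*-rawRing public
  using (polyRawRing; constant; indeterminate) renaming (Poly to ℤ[x])

module ℚ[x] = Polynomial ℚ.+-*-rawRing

charPoly : ∀ {k} → Matrix k → ℤ[x]
charPoly A = Mat.det (λ i j → indeterminate * Mat.1ᴹ i j + (- constant (A i j)))
  where
  open RawRing polyRawRing
  module Mat = SquareMatrix polyRawRing

IrreducibleOverℚ : Pred ℤ[x] 0ℓ
IrreducibleOverℚ p = Irreducible (List.map fromℤ p)
  where open RawSemiringDefinitions (RawRing.rawSemiring ℚ[x].polyRawRing)

M : (k : ℕ) → Pred (Matrix k) 0ℓ
M k A = IrreducibleOverℚ (charPoly A)

SL : (k : ℕ) → Pred (Matrix k) 0ℓ
SL k X = det X ≡ ℤ.1ℤ

norm : ∀ {k} → Matrix k → ℕ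
norm A = Vector.foldr ℕ._+_ 0 (λ i → Vector.foldr ℕ._+_ 0 (λ j → ℤ.∣ A i j ∣))

-- The vector a = (a₁, …, a_k), where k = suc n, is indexed from zero, so that
-- its reverse is the last row (a_k, …, a₁).
frobenius : ∀ {n} → Vector ℤ (suc n) → Matrix (suc n)
frobenius a i with view i
... | ‵fromℕ      = Vector.reverse a
... | ‵inject₁ i′ = ℤ.0ℤ Vector.∷ 1ᴹ i′

Commute : ∀ {k} → Matrix k → Matrix k → Set
Commute A B = A *ᴹ B ≈ᴹ B *ᴹ A

IsInverse : ∀ {k} → Matrix k → Matrix k → Set
IsInverse X Y = X *ᴹ Y ≈ᴹ 1ᴹ × Y *ᴹ X ≈ᴹ 1ᴹ

FrobeniusType : ∀ {n} → Pred (Matrix (suc n)) 0ℓ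
FrobeniusType {n} A =
  ∃[ a ] ∃[ X ] ∃[ X⁻¹ ]
    X ∈ SL (suc n) × IsInverse X X⁻¹ ×
    Commute (X *ᴹ A *ᴹ X⁻¹) (frobenius a)

{-# OPTIONS --safe #-}

-- If B commutes with A and a row vector v satisfies det (v, vB, vB²) = 1, then
-- A is of Frobenius type: with X the matrix with rows v, vB, vB², the first two
-- rows of XBX⁻¹ are the second and third unit vectors, so XBX⁻¹ is a Frobenius
-- matrix, and it commutes with XAX⁻¹.  On the other hand, an integer root of the
-- characteristic polynomial of A makes it reducible.  Only finitely many A have
-- norm at most 6, and evaluation shows that each of them has a characteristic
-- polynomial with an integer root or admits such B and v.

module Submission where

open import Defs
open import Data.Nat.Base using (_≤_)
open import Relation.Unary using (_∈_)

open import Algebra.Bundles using (Monoid)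
open import Algebra.Bundles.Raw using (RawRing)
import Algebra.Definitions.RawMagma as RawMagma
import Algebra.Definitions.RawSemiring as RawSemiringDefinitions
import Algebra.Properties.Monoid as MonoidProperties
import Algebra.Properties.Semiring.Sum as SemiringSum
open import Data.Fin.Base using (Fin; zero; suc; toℕ)
open import Data.Fin.Patterns using (0F; 1F; 2F)
open import Data.Fin.Properties as Finₚ using (∀-cons)
open import Data.Integer.Base as ℤ using (ℤ; +_; -[1+_]; 0ℤ; 1ℤ; ∣_∣)
open import Data.Integer.DivMod using (_/ℕ_)
import Data.Integer.Properties as ℤₚ
open import Data.Integer.Solver using (module +-*-Solver)
open import Data.List.Base as List using (List; []; _∷_; _++_; concatMap)
import Data.List.Membership.Propositional as Membership
open import Data.List.Membership.Propositional.Properties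
  using (∈-++⁺ˡ; ∈-++⁺ʳ; ∈-map⁺; ∈-concatMap⁺)
open import Data.List.Relation.Unary.All as All using (All)
open import Data.List.Relation.Unary.All.Properties using (all⁺)
open import Data.List.Relation.Unary.Any as Any using (Any; here; there; any?)
open import Data.Nat.Base as ℕ using (ℕ; zero; suc; s≤s; _∸_)
import Data.Nat.Properties as ℕₚ
import Data.Nat.Solver as ℕSolver
open import Data.Product.Base using (∃; _×_; _,_)
open import Data.Rational.Base as ℚ using (ℚ; 0ℚ; 1ℚ)
open import Data.Rational.Literals using (fromℤ)
import Data.Rational.Properties as ℚₚ
open import Data.Sum.Base using (_⊎_; inj₁; inj₂)
open import Data.Vec.Base as Vec using (Vec; []; _∷_)
open import Data.Vec.Functional as Vector using (Vector)
open import Function.Base using (_∘_)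
open import Level using (0ℓ)
open import Relation.Binary.PropositionalEquality
  using (_≡_; refl; sym; trans; cong; cong₂; module ≡-Reasoning)
open import Relation.Nullary.Decidable using (Dec; isYes; toWitness; _×-dec_; _⊎-dec_)
open import Relation.Nullary.Negation.Core using (¬_; contradiction)
open import Relation.Unary using (Decidable)

-- The monoid of integer square matrices.

open SemiringSum ℤₚ.+-*-semiring
  using (sum; sum-cong-≗; sum-replicate-zero; ∑-comm; *-distribˡ-sum; *-distribʳ-sum)

sum-1ᴹˡ : ∀ {n} i (u : Vector ℤ n) → sum (λ l → 1ᴹ i l ℤ.* u l) ≡ u i
sum-1ᴹˡ {suc n} zero u = begin
  1ℤ ℤ.* u zero ℤ.+ sum (λ l → 0ℤ ℤ.* u (suc l))
    ≡⟨ cong₂ ℤ._+_ (ℤₚ.*-identityˡ (u zero)) (sum-cong-≗ (λ l → ℤₚ.*-zeroˡ (u (suc l)))) ⟩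
  u zero ℤ.+ sum (Vector.replicate n 0ℤ)
    ≡⟨ cong (ℤ._+_ (u zero)) (sum-replicate-zero n) ⟩
  u zero ℤ.+ 0ℤ
    ≡⟨ ℤₚ.+-identityʳ (u zero) ⟩
  u zero ∎
  where open ≡-Reasoning
sum-1ᴹˡ {suc n} (suc i) u =
  trans (cong₂ ℤ._+_ (ℤₚ.*-zeroˡ (u zero)) (sum-1ᴹˡ i (λ l → u (suc l)))) (ℤₚ.+-identityˡ (u (suc i)))

1ᴹ-symmetric : ∀ {n} (i j : Fin n) → 1ᴹ i j ≡ 1ᴹ j i
1ᴹ-symmetric zero    zero    = refl
1ᴹ-symmetric zero    (suc j) = refl
1ᴹ-symmetric (suc i) zero    = refl
1ᴹ-symmetric (suc i) (suc j) = 1ᴹ-symmetric i j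

*ᴹ-cong : ∀ {n} {A A′ B B′ : Matrix n} → A ≈ᴹ A′ → B ≈ᴹ B′ → A *ᴹ B ≈ᴹ A′ *ᴹ B′
*ᴹ-cong A≈A′ B≈B′ i j = sum-cong-≗ (λ l → cong₂ ℤ._*_ (A≈A′ i l) (B≈B′ l j))

*ᴹ-assoc : ∀ {n} (A B C : Matrix n) → (A *ᴹ B) *ᴹ C ≈ᴹ A *ᴹ (B *ᴹ C)
*ᴹ-assoc A B C i j = begin
  sum (λ l → sum (λ k → A i k ℤ.* B k l) ℤ.* C l j)
    ≡⟨ sum-cong-≗ (λ l → *-distribʳ-sum (C l j) (λ k → A i k ℤ.* B k l)) ⟩
  sum (λ l → sum (λ k → A i k ℤ.* B k l ℤ.* C l j))
    ≡⟨ ∑-comm (λ l k → A i k ℤ.* B k l ℤ.* C l j) ⟩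
  sum (λ k → sum (λ l → A i k ℤ.* B k l ℤ.* C l j))
    ≡⟨ sum-cong-≗ (λ k → sum-cong-≗ (λ l → ℤₚ.*-assoc (A i k) (B k l) (C l j))) ⟩
  sum (λ k → sum (λ l → A i k ℤ.* (B k l ℤ.* C l j)))
    ≡⟨ sum-cong-≗ (λ k → *-distribˡ-sum (A i k) (λ l → B k l ℤ.* C l j)) ⟨
  sum (λ k → A i k ℤ.* sum (λ l → B k l ℤ.* C l j)) ∎
  where open ≡-Reasoning

*ᴹ-identityˡ : ∀ {n} (A : Matrix n) → 1ᴹ *ᴹ A ≈ᴹ A
*ᴹ-identityˡ A i j = sum-1ᴹˡ i (λ l → A l j)

*ᴹ-identityʳ : ∀ {n} (A : Matrix n) → A *ᴹ 1ᴹ ≈ᴹ A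
*ᴹ-identityʳ A i j = trans
  (sum-cong-≗ (λ l → trans (cong (A i l ℤ.*_) (1ᴹ-symmetric l j)) (ℤₚ.*-comm (A i l) (1ᴹ j l))))
  (sum-1ᴹˡ j (A i))

*ᴹ-monoid : ℕ → Monoid 0ℓ 0ℓ
*ᴹ-monoid n = record
  { Carrier  = Matrix n
  ; _≈_      = _≈ᴹ_
  ; _∙_      = _*ᴹ_
  ; ε        = 1ᴹ
  ; isMonoid = record
    { isSemigroup = record
      { isMagma = record
        { isEquivalence = record
          { refl  = λ i j → refl
          ; sym   = λ A≈B i j → sym (A≈B i j)
          ; trans = λ A≈B B≈C i j → trans (A≈B i j) (B≈C i j)
          }
        ; ∙-cong = *ᴹ-cong
        }
      ; assoc = *ᴹ-assoc
      }
    ; identity = *ᴹ-identityˡ , *ᴹ-identityʳ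
    }
  }

-- Conjugation and commutation.

module _ {c ℓ} (M : Monoid c ℓ) where
  open Monoid M
  open MonoidProperties M using (cancelᶜ)

  -- In either product the inner factor `y ∙ x` cancels, which leaves `a ∙ b` or `b ∙ a` between `x`
  -- and `y`.
  conjugates-commute : ∀ {x y} → y ∙ x ≈ ε → ∀ {a b} → a ∙ b ≈ b ∙ a →
                       (x ∙ a ∙ y) ∙ (x ∙ b ∙ y) ≈ (x ∙ b ∙ y) ∙ (x ∙ a ∙ y)
  conjugates-commute {x} {y} yx≈1 {a} {b} ab≈ba = begin
    (x ∙ a ∙ y) ∙ (x ∙ b ∙ y) ≈⟨ product a b ⟩
    x ∙ (a ∙ b) ∙ y           ≈⟨ ∙-congʳ (∙-congˡ ab≈ba) ⟩
    x ∙ (b ∙ a) ∙ y           ≈⟨ product b a ⟨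
    (x ∙ b ∙ y) ∙ (x ∙ a ∙ y) ∎
    where
    open import Relation.Binary.Reasoning.Setoid setoid
    product : ∀ a b → (x ∙ a ∙ y) ∙ (x ∙ b ∙ y) ≈ x ∙ (a ∙ b) ∙ y
    product a b = begin
      (x ∙ a ∙ y) ∙ (x ∙ b ∙ y) ≈⟨ ∙-congˡ (assoc x b y) ⟩
      (x ∙ a ∙ y) ∙ (x ∙ (b ∙ y)) ≈⟨ cancelᶜ yx≈1 (x ∙ a) (b ∙ y) ⟩
      x ∙ a ∙ (b ∙ y)           ≈⟨ assoc (x ∙ a) b y ⟨
      x ∙ a ∙ b ∙ y             ≈⟨ ∙-congʳ (assoc x a b) ⟩
      x ∙ (a ∙ b) ∙ y           ∎

Commute-cong : ∀ {n} {A A′ B B′ : Matrix n} → A ≈ᴹ A′ → B ≈ᴹ B′ → Commute A B → Commute A′ B′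
Commute-cong {A = A} {A′} {B} {B′} A≈A′ B≈B′ AB≈BA i j = begin
  (A′ *ᴹ B′) i j ≡⟨ *ᴹ-cong A≈A′ B≈B′ i j ⟨
  (A *ᴹ B) i j   ≡⟨ AB≈BA i j ⟩
  (B *ᴹ A) i j   ≡⟨ *ᴹ-cong B≈B′ A≈A′ i j ⟩
  (B′ *ᴹ A′) i j ∎
  where open ≡-Reasoning

-- Determinant and adjugate of a 3 × 3 matrix.

module Explicit {c ℓ} (R : RawRing c ℓ) where
  open RawRing R
  open RawSemiringDefinitions rawSemiring using (_^_)
  module S = SquareMatrix R

  infixl 6 _-_
  _-_ : Carrier → Carrier → Carrier
  a - b = a + - b

  -- The transposed cofactor matrix, which is the inverse when the determinant is 1.
  adjugate : ∀ {n} → S.Matrix (suc n) → S.Matrix (suc n)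
  adjugate A i j = (- 1#) ^ (toℕ i ℕ.+ toℕ j) * S.det (S.minor j i A)

  -- The coefficients of the characteristic polynomial x³ − e₁ x² + e₂ x − e₃,
  -- in closed form for fast evaluation.
  e₁ e₂ e₃ : Vec Carrier 9 → Carrier
  e₁ (a ∷ b ∷ c ∷ d ∷ e ∷ f ∷ g ∷ h ∷ i ∷ []) = a + e + i
  e₂ (a ∷ b ∷ c ∷ d ∷ e ∷ f ∷ g ∷ h ∷ i ∷ []) =
    (a * e - b * d) + (a * i - c * g) + (e * i - f * h)
  e₃ (a ∷ b ∷ c ∷ d ∷ e ∷ f ∷ g ∷ h ∷ i ∷ []) =
    a * (e * i - f * h) - b * (d * i - f * g) + c * (d * h - e * g)

  -- The quotient of x³ − e₁ x² + e₂ x − e₃ by x − r is x² + q₁ x + q₀, with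
  -- remainder r q₀ − e₃.
  q₁ : Carrier → Carrier → Carrier
  q₁ e₁ r = r - e₁

  q₀ : Carrier → Carrier → Carrier → Carrier
  q₀ e₁ e₂ r = e₂ + r * q₁ e₁ r

open Explicit ℤ.+-*-rawRing using (adjugate; e₁; e₂; e₃; q₁; q₀)

-- Running the definitions over this ring of formal expressions reifies them
-- for the ring solver.
syntaxRing : ℕ → RawRing 0ℓ 0ℓ
syntaxRing n = record
  { Carrier = Polynomial n
  ; _≈_     = _≡_
  ; _+_     = _:+_
  ; _*_     = _:*_
  ; -_      = :-_
  ; 0#      = con 0ℤ
  ; 1#      = con 1ℤ
  }
  where open +-*-Solver

entries : Matrix 3 → Vec ℤ 9
entries A = A 0F 0F ∷ A 0F 1F ∷ A 0F 2F ∷ A 1F 0F ∷ A 1F 1F ∷ A 1F 2F ∷ A 2F 0F ∷ A 2F 1F ∷ A 2F 2F ∷ []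

-- Polymorphic in the entries, so that it also builds the formal matrices given to the solvers.
toMatrix : ∀ {a} {A : Set a} → Vec A 9 → Vector (Vector A 3) 3
toMatrix (a ∷ b ∷ c ∷ d ∷ e ∷ f ∷ g ∷ h ∷ i ∷ []) 0F 0F = a
toMatrix (a ∷ b ∷ c ∷ d ∷ e ∷ f ∷ g ∷ h ∷ i ∷ []) 0F 1F = b
toMatrix (a ∷ b ∷ c ∷ d ∷ e ∷ f ∷ g ∷ h ∷ i ∷ []) 0F 2F = c
toMatrix (a ∷ b ∷ c ∷ d ∷ e ∷ f ∷ g ∷ h ∷ i ∷ []) 1F 0F = d
toMatrix (a ∷ b ∷ c ∷ d ∷ e ∷ f ∷ g ∷ h ∷ i ∷ []) 1F 1F = e
toMatrix (a ∷ b ∷ c ∷ d ∷ e ∷ f ∷ g ∷ h ∷ i ∷ []) 1F 2F = f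
toMatrix (a ∷ b ∷ c ∷ d ∷ e ∷ f ∷ g ∷ h ∷ i ∷ []) 2F 0F = g
toMatrix (a ∷ b ∷ c ∷ d ∷ e ∷ f ∷ g ∷ h ∷ i ∷ []) 2F 1F = h
toMatrix (a ∷ b ∷ c ∷ d ∷ e ∷ f ∷ g ∷ h ∷ i ∷ []) 2F 2F = i

pointwise : ∀ {p} {P : Fin 3 → Fin 3 → Set p} →
            P 0F 0F → P 0F 1F → P 0F 2F →
            P 1F 0F → P 1F 1F → P 1F 2F →
            P 2F 0F → P 2F 1F → P 2F 2F → ∀ i j → P i j
pointwise a b c d e f g h i = ∀-cons (∀-cons a (∀-cons b (∀-cons c λ())))
  (∀-cons (∀-cons d (∀-cons e (∀-cons f λ()))) (∀-cons (∀-cons g (∀-cons h (∀-cons i λ()))) λ()))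

toMatrix-entries : ∀ A → toMatrix (entries A) ≈ᴹ A
toMatrix-entries A = pointwise refl refl refl refl refl refl refl refl refl

module _ (X : Matrix 3) where
  private
    R̂ = syntaxRing 9
    module S = SquareMatrix R̂
    module E = Explicit R̂
    open RawRing R̂ using (Carrier; _*_)
    open +-*-Solver using (var; prove)

    x̂ : Vec Carrier 9
    x̂ = Vec.map var (Vec.allFin 9)

    X̂ : S.Matrix 3
    X̂ = toMatrix x̂

  det≡e₃ : det X ≡ e₃ (entries X)
  det≡e₃ = prove (entries X) (S.det X̂) (E.e₃ x̂) refl

  *ᴹ-adjugate : X *ᴹ adjugate X ≈ᴹ λ i j → det X ℤ.* 1ᴹ i j
  *ᴹ-adjugate = pointwise
    (entry 0F 0F refl) (entry 0F 1F refl) (entry 0F 2F refl)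
    (entry 1F 0F refl) (entry 1F 1F refl) (entry 1F 2F refl)
    (entry 2F 0F refl) (entry 2F 1F refl) (entry 2F 2F refl)
    where
    entry = λ i j →
      prove (entries X) ((X̂ S.*ᴹ E.adjugate X̂) i j) (S.det X̂ * S.1ᴹ i j)

  adjugate-*ᴹ : adjugate X *ᴹ X ≈ᴹ λ i j → det X ℤ.* 1ᴹ i j
  adjugate-*ᴹ = pointwise
    (entry 0F 0F refl) (entry 0F 1F refl) (entry 0F 2F refl)
    (entry 1F 0F refl) (entry 1F 1F refl) (entry 1F 2F refl)
    (entry 2F 0F refl) (entry 2F 1F refl) (entry 2F 2F refl)
    where
    entry = λ i j →
      prove (entries X) ((E.adjugate X̂ S.*ᴹ X̂) i j) (S.det X̂ * S.1ᴹ i j)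

-- From a cyclic row vector to a Frobenius matrix.

module _ {A B X : Matrix 3} (AB≈BA : Commute A B) (X∈SL : X ∈ SL 3)
         (row₁ : ∀ j → X 1F j ≡ (X *ᴹ B) 0F j)
         (row₂ : ∀ j → X 2F j ≡ (X *ᴹ B) 1F j) where
  private
    X⁻¹ C : Matrix 3
    X⁻¹ = adjugate X
    C   = X *ᴹ B *ᴹ X⁻¹

    det-X-* : ∀ u → det X ℤ.* u ≡ u
    det-X-* u = trans (cong (ℤ._* u) X∈SL) (ℤₚ.*-identityˡ u)

    inverseʳ : X *ᴹ X⁻¹ ≈ᴹ 1ᴹ
    inverseʳ i j = trans (*ᴹ-adjugate X i j) (det-X-* (1ᴹ i j))

    inverseˡ : X⁻¹ *ᴹ X ≈ᴹ 1ᴹ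
    inverseˡ i j = trans (adjugate-*ᴹ X i j) (det-X-* (1ᴹ i j))

    -- Row 0 of `X *ᴹ B` is row 1 of `X`, so row 0 of `C` is row 1 of `X *ᴹ X⁻¹`.
    C-row₀ : ∀ j → C 0F j ≡ 1ᴹ 1F j
    C-row₀ j = trans (sum-cong-≗ (λ l → cong (ℤ._* X⁻¹ l j) (sym (row₁ l)))) (inverseʳ 1F j)

    C-row₁ : ∀ j → C 1F j ≡ 1ᴹ 2F j
    C-row₁ j = trans (sum-cong-≗ (λ l → cong (ℤ._* X⁻¹ l j) (sym (row₂ l)))) (inverseʳ 2F j)

    -- Since `frobenius` reverses its argument, the reversed last row of `C` is the right
    -- coefficient vector, and the last row agrees by computation.
    C≈frobenius : C ≈ᴹ frobenius (Vector.reverse (C 2F))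
    C≈frobenius = pointwise
      (C-row₀ 0F) (C-row₀ 1F) (C-row₀ 2F)
      (C-row₁ 0F) (C-row₁ 1F) (C-row₁ 2F)
      refl refl refl

  cyclic-row⇒frobeniusType : A ∈ FrobeniusType
  cyclic-row⇒frobeniusType =
    Vector.reverse (C 2F) , X , X⁻¹ , X∈SL , (inverseʳ , inverseˡ) ,
    Commute-cong {A = X *ᴹ A *ᴹ X⁻¹} {B = C} (λ i j → refl) C≈frobenius
      (conjugates-commute (*ᴹ-monoid 3) {X} {X⁻¹} inverseˡ {A} {B} AB≈BA)

-- Polynomials over ℚ and monic factors.

open ℚ[x] using (coeff; _+ᴾ_; _*ᴾ_; _≈ᴾ_; Poly)
open RawSemiringDefinitions (RawRing.rawSemiring ℚ[x].polyRawRing) using (_∤_; mkIrred)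
module ℤ[x]ᴾ = Polynomial ℤ.+-*-rawRing

fromℤ-+ : ∀ m n → fromℤ (m ℤ.+ n) ≡ fromℤ m ℚ.+ fromℤ n
fromℤ-+ m n = trans (sym (ℚₚ.↥p/↧p≡p (fromℤ (m ℤ.+ n))))
  (cong (ℚ._/ 1) (sym (cong₂ ℤ._+_ (ℤₚ.*-identityʳ m) (ℤₚ.*-identityʳ n))))

fromℤ-* : ∀ m n → fromℤ (m ℤ.* n) ≡ fromℤ m ℚ.* fromℤ n
fromℤ-* m n = sym (ℚₚ.↥p/↧p≡p (fromℤ (m ℤ.* n)))

coeff-map-fromℤ : ∀ p n → coeff (List.map fromℤ p) n ≡ fromℤ (ℤ[x]ᴾ.coeff p n)
coeff-map-fromℤ []      n       = refl
coeff-map-fromℤ (a ∷ p) zero    = refl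
coeff-map-fromℤ (a ∷ p) (suc n) = coeff-map-fromℤ p n

map-fromℤ-+ᴾ : ∀ p q → List.map fromℤ (p ℤ[x]ᴾ.+ᴾ q) ≡ List.map fromℤ p +ᴾ List.map fromℤ q
map-fromℤ-+ᴾ []      q       = refl
map-fromℤ-+ᴾ (a ∷ p) []      = refl
map-fromℤ-+ᴾ (a ∷ p) (b ∷ q) = cong₂ _∷_ (fromℤ-+ a b) (map-fromℤ-+ᴾ p q)

map-fromℤ-scale : ∀ a q → List.map fromℤ (List.map (a ℤ.*_) q) ≡ List.map (fromℤ a ℚ.*_) (List.map fromℤ q)
map-fromℤ-scale a []      = refl
map-fromℤ-scale a (b ∷ q) = cong₂ _∷_ (fromℤ-* a b) (map-fromℤ-scale a q)

map-fromℤ-*ᴾ : ∀ p q → List.map fromℤ (p ℤ[x]ᴾ.*ᴾ q) ≡ List.map fromℤ p *ᴾ List.map fromℤ q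
map-fromℤ-*ᴾ []      q = refl
map-fromℤ-*ᴾ (a ∷ p) q = trans (map-fromℤ-+ᴾ (List.map (a ℤ.*_) q) (0ℤ ∷ p ℤ[x]ᴾ.*ᴾ q))
  (cong₂ _+ᴾ_ (map-fromℤ-scale a q) (cong (0ℚ ∷_) (map-fromℤ-*ᴾ p q)))

coeff-+ᴾ : ∀ p q n → coeff (p +ᴾ q) n ≡ coeff p n ℚ.+ coeff q n
coeff-+ᴾ []      q       n       = sym (ℚₚ.+-identityˡ (coeff q n))
coeff-+ᴾ (a ∷ p) []      n       = sym (ℚₚ.+-identityʳ (coeff (a ∷ p) n))
coeff-+ᴾ (a ∷ p) (b ∷ q) zero    = refl
coeff-+ᴾ (a ∷ p) (b ∷ q) (suc n) = coeff-+ᴾ p q n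

coeff-scale : ∀ a p n → coeff (List.map (a ℚ.*_) p) n ≡ a ℚ.* coeff p n
coeff-scale a []      n       = sym (ℚₚ.*-zeroʳ a)
coeff-scale a (b ∷ p) zero    = refl
coeff-scale a (b ∷ p) (suc n) = coeff-scale a p n

coeff-∷-*ᴾ : ∀ a q p n → coeff ((a ∷ q) *ᴾ p) n ≡ a ℚ.* coeff p n ℚ.+ coeff (0ℚ ∷ q *ᴾ p) n
coeff-∷-*ᴾ a q p n = trans (coeff-+ᴾ (List.map (a ℚ.*_) p) (0ℚ ∷ q *ᴾ p) n)
  (cong (ℚ._+ coeff (0ℚ ∷ q *ᴾ p) n) (coeff-scale a p n))

0∷-≈ᴾ : ∀ {p} → p ≈ᴾ [] → (0ℚ ∷ p) ≈ᴾ []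
0∷-≈ᴾ p≈0 zero    = refl
0∷-≈ᴾ p≈0 (suc n) = p≈0 n

*ᴾ-zeroˡ : ∀ q → q ≈ᴾ [] → ∀ p → (q *ᴾ p) ≈ᴾ []
*ᴾ-zeroˡ []      q≈0 p n = refl
*ᴾ-zeroˡ (b ∷ q) q≈0 p n = begin
  coeff ((b ∷ q) *ᴾ p) n                     ≡⟨ coeff-∷-*ᴾ b q p n ⟩
  b ℚ.* coeff p n ℚ.+ coeff (0ℚ ∷ q *ᴾ p) n  ≡⟨ cong₂ ℚ._+_ (cong (ℚ._* coeff p n) (q≈0 0)) (0∷-≈ᴾ (*ᴾ-zeroˡ q (λ m → q≈0 (suc m)) p) n) ⟩
  0ℚ ℚ.* coeff p n ℚ.+ 0ℚ                    ≡⟨ cong (ℚ._+ 0ℚ) (ℚₚ.*-zeroˡ (coeff p n)) ⟩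
  0ℚ                                         ∎
  where open ≡-Reasoning

record Monic (d : ℕ) (p : Poly) : Set where
  field
    leading : coeff p d ≡ 1ℚ
    beyond  : ∀ {n} → d ℕ.< n → coeff p n ≡ 0ℚ

module _ {d p} (monic : Monic d p) where
  open Monic monic
  open ≡-Reasoning

  -- Induction on `q`. For `n ≥ d` the term `a ℚ.* coeff p (suc n)` vanishes, so the hypothesis
  -- passes from `a ∷ q` to `q`. Once `q` is zero, the coefficient of degree `d` of the product is
  -- `a` itself.
  *ᴾ-monic-degree : ∀ q → (∀ {n} → d ℕ.≤ n → coeff (q *ᴾ p) n ≡ 0ℚ) → q ≈ᴾ []
  *ᴾ-monic-degree []      qp<d n = refl
  *ᴾ-monic-degree (a ∷ q) qp<d = λ { zero → a≡0 ; (suc n) → q≈0 n }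
    where
    q≈0 : q ≈ᴾ []
    q≈0 = *ᴾ-monic-degree q λ {n} d≤n → begin
      coeff (q *ᴾ p) n                            ≡⟨ ℚₚ.+-identityˡ _ ⟨
      0ℚ ℚ.+ coeff (q *ᴾ p) n                     ≡⟨ cong (ℚ._+ coeff (q *ᴾ p) n) (ℚₚ.*-zeroʳ a) ⟨
      a ℚ.* 0ℚ ℚ.+ coeff (q *ᴾ p) n               ≡⟨ cong (λ x → a ℚ.* x ℚ.+ coeff (q *ᴾ p) n) (beyond (s≤s d≤n)) ⟨
      a ℚ.* coeff p (suc n) ℚ.+ coeff (q *ᴾ p) n  ≡⟨ coeff-∷-*ᴾ a q p (suc n) ⟨
      coeff ((a ∷ q) *ᴾ p) (suc n)                ≡⟨ qp<d (ℕₚ.m≤n⇒m≤1+n d≤n) ⟩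
      0ℚ                                          ∎

    a≡0 : a ≡ 0ℚ
    a≡0 = begin
      a                                          ≡⟨ ℚₚ.*-identityʳ a ⟨
      a ℚ.* 1ℚ                                   ≡⟨ cong (a ℚ.*_) leading ⟨
      a ℚ.* coeff p d                            ≡⟨ ℚₚ.+-identityʳ _ ⟨
      a ℚ.* coeff p d ℚ.+ 0ℚ                     ≡⟨ cong (a ℚ.* coeff p d ℚ.+_) (0∷-≈ᴾ (*ᴾ-zeroˡ q q≈0 p) d) ⟨
      a ℚ.* coeff p d ℚ.+ coeff (0ℚ ∷ q *ᴾ p) d  ≡⟨ coeff-∷-*ᴾ a q p d ⟨
      coeff ((a ∷ q) *ᴾ p) d                     ≡⟨ qp<d ℕₚ.≤-refl ⟩
      0ℚ                                         ∎

-- A cofactor `q` would give a product of degree 0, below that of `p`; hence `q` is zero and so is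
-- the product.
monic∤1 : ∀ {d p} → Monic (suc d) p → p ∤ (1ℚ ∷ [])
monic∤1 {p = p} monic (q RawMagma., qp≈1) = 0≢1 (trans (sym (*ᴾ-zeroˡ q q≈0 p 0)) (qp≈1 0))
  where
  q≈0 : q ≈ᴾ []
  -- An index of at least `suc d` is positive, where the polynomial 1 has coefficient 0.
  q≈0 = *ᴾ-monic-degree monic q λ { (s≤s {n = n} _) → qp≈1 (suc n) }
  0≢1 : ¬ (0ℚ ≡ 1ℚ)
  0≢1 ()

linear-monic : ∀ a → Monic 1 (a ∷ 1ℚ ∷ [])
linear-monic a = record { leading = refl ; beyond = λ { (s≤s (s≤s _)) → refl } }

quadratic-monic : ∀ a b → Monic 2 (a ∷ b ∷ 1ℚ ∷ [])
quadratic-monic a b = record { leading = refl ; beyond = λ { (s≤s (s≤s (s≤s _))) → refl } }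

-- Irreducibility would make one factor a unit, but both are monic of positive degree.
linear*quadratic-reducible : ∀ {p} a b c → p ℤ[x]ᴾ.≈ᴾ (a ∷ 1ℤ ∷ []) ℤ[x]ᴾ.*ᴾ (b ∷ c ∷ 1ℤ ∷ []) →
                             ¬ IrreducibleOverℚ p
linear*quadratic-reducible {p} a b c p≈xy (mkIrred _ split) with split mapped
  where
  open ≡-Reasoning
  x = a ∷ 1ℤ ∷ []
  y = b ∷ c ∷ 1ℤ ∷ []
  mapped : List.map fromℤ p ≈ᴾ List.map fromℤ x *ᴾ List.map fromℤ y
  mapped n = begin
    coeff (List.map fromℤ p) n                      ≡⟨ coeff-map-fromℤ p n ⟩
    fromℤ (ℤ[x]ᴾ.coeff p n)                         ≡⟨ cong fromℤ (p≈xy n) ⟩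
    fromℤ (ℤ[x]ᴾ.coeff (x ℤ[x]ᴾ.*ᴾ y) n)            ≡⟨ coeff-map-fromℤ (x ℤ[x]ᴾ.*ᴾ y) n ⟨
    coeff (List.map fromℤ (x ℤ[x]ᴾ.*ᴾ y)) n         ≡⟨ cong (λ z → coeff z n) (map-fromℤ-*ᴾ x y) ⟩
    coeff (List.map fromℤ x *ᴾ List.map fromℤ y) n  ∎
... | inj₁ x∣1 = monic∤1 (linear-monic (fromℤ a)) x∣1
... | inj₂ y∣1 = monic∤1 (quadratic-monic (fromℤ b) (fromℤ c)) y∣1

-- Splitting off an integer root of the characteristic polynomial.

module _ (A : Matrix 3) (r : ℤ) where
  private
    R̂ = syntaxRing 10
    open RawRing R̂
    open Explicit R̂ using (_-_) renaming (e₁ to ê₁; e₂ to ê₂; e₃ to ê₃; q₁ to q̂₁; q₀ to q̂₀)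
    open +-*-Solver using (var; prove)
    module P = Polynomial R̂
    module Pᴿ = RawRing P.polyRawRing
    module Pᴹ = SquareMatrix P.polyRawRing

    r̂ : Carrier
    r̂ = var 0F

    â : Vec Carrier 9
    â = Vec.map (λ i → var (suc i)) (Vec.allFin 9)

    charPolyˢ productˢ : P.Poly
    charPolyˢ = Pᴹ.det λ i j →
      P.indeterminate Pᴿ.* Pᴹ.1ᴹ i j Pᴿ.+ Pᴿ.- P.constant (toMatrix â i j)
    productˢ = (- r̂ ∷ 1# ∷ []) P.*ᴾ (q̂₀ (ê₁ â) (ê₂ â) r̂ ∷ q̂₁ (ê₁ â) r̂ ∷ 1# ∷ [])

    ρ : Vec ℤ 10
    ρ = r ∷ entries A

    E₁ E₂ E₃ Q₀ : ℤ
    E₁ = e₁ (entries A)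
    E₂ = e₂ (entries A)
    E₃ = e₃ (entries A)
    Q₀ = q₀ E₁ E₂ r

    product : ℤ[x]
    product = (ℤ.- r ∷ 1ℤ ∷ []) ℤ[x]ᴾ.*ᴾ (Q₀ ∷ q₁ E₁ r ∷ 1ℤ ∷ [])

  -- The coefficient list of charPoly A has trailing zeros beyond degree 3.
  charPoly-factor : r ℤ.* Q₀ ≡ E₃ → charPoly A ℤ[x]ᴾ.≈ᴾ product
  charPoly-factor root = λ where
      0 → begin
        ℤ[x]ᴾ.coeff (charPoly A) 0
          -- The constant coefficients differ by the remainder of the division by x - r, which
          -- `root` makes zero.
          ≡⟨ prove ρ (P.coeff charPolyˢ 0)
               (P.coeff productˢ 0 + (r̂ * q̂₀ (ê₁ â) (ê₂ â) r̂ - ê₃ â)) refl ⟩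
        ℤ[x]ᴾ.coeff product 0 ℤ.+ (r ℤ.* Q₀ ℤ.- E₃)
          ≡⟨ cong (ℤ._+_ (ℤ[x]ᴾ.coeff product 0)) (ℤₚ.i≡j⇒i-j≡0 root) ⟩
        ℤ[x]ᴾ.coeff product 0 ℤ.+ 0ℤ
          ≡⟨ ℤₚ.+-identityʳ _ ⟩
        ℤ[x]ᴾ.coeff product 0 ∎
      1 → same 1 refl
      2 → same 2 refl
      3 → same 3 refl
      4 → same 4 refl
      5 → same 5 refl
      6 → same 6 refl
      7 → same 7 refl
      8 → same 8 refl
      (suc (suc (suc (suc (suc (suc (suc (suc (suc n))))))))) → refl
    where
    open ≡-Reasoning
    same = λ n → prove ρ (P.coeff charPolyˢ n) (P.coeff productˢ n)

  root⇒reducible : r ℤ.* Q₀ ≡ E₃ → ¬ A ∈ M 3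
  root⇒reducible root =
    linear*quadratic-reducible {charPoly A} (ℤ.- r) Q₀ (q₁ E₁ r) (charPoly-factor root)

-- Enumeration of the integer vectors of bounded norm.

interval : ℕ → List ℤ
interval zero    = 0ℤ ∷ []
interval (suc b) = interval b ++ + suc b ∷ -[1+ b ] ∷ []

∥_∥₁ : ∀ {n} → Vec ℤ n → ℕ
∥ []     ∥₁ = 0
∥ x ∷ xs ∥₁ = ∣ x ∣ ℕ.+ ∥ xs ∥₁

ball : ∀ n → ℕ → List (Vec ℤ n)
ball zero    b = [] ∷ []
ball (suc n) b = concatMap (λ x → List.map (x ∷_) (ball n (b ∸ ∣ x ∣))) (interval b)

∈-interval : ∀ b x → ∣ x ∣ ≤ b → x Membership.∈ interval b
∈-interval zero    (+ zero) _ = here refl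
∈-interval (suc b) x ∣x∣≤1+b with ℕₚ.m≤n⇒m<n∨m≡n ∣x∣≤1+b
∈-interval (suc b) x        _ | inj₁ (s≤s ∣x∣≤b) = ∈-++⁺ˡ (∈-interval b x ∣x∣≤b)
∈-interval (suc b) (+ _)    _ | inj₂ refl = ∈-++⁺ʳ (interval b) (here refl)
∈-interval (suc b) -[1+ _ ] _ | inj₂ refl = ∈-++⁺ʳ (interval b) (there (here refl))

∈-ball : ∀ {n} b (xs : Vec ℤ n) → ∥ xs ∥₁ ≤ b → xs Membership.∈ ball n b
∈-ball b []       _ = here refl
∈-ball b (x ∷ xs) ∥x∷xs∥≤b = ∈-concatMap⁺ (λ y → List.map (y ∷_) (ball _ (b ∸ ∣ y ∣)))
  (Any.map (λ { refl → ∈-map⁺ (x ∷_) (∈-ball (b ∸ ∣ x ∣) xs ∥xs∥≤b∸∣x∣) })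
    (∈-interval b x (ℕₚ.m+n≤o⇒m≤o ∣ x ∣ ∥x∷xs∥≤b)))
  where
  ∥xs∥≤b∸∣x∣ = ℕₚ.m+n≤o⇒m≤o∸n ∥ xs ∥₁ (ℕₚ.≤-trans (ℕₚ.≤-reflexive (ℕₚ.+-comm ∥ xs ∥₁ ∣ x ∣)) ∥x∷xs∥≤b)

-- Both sides add the same nine absolute values, bracketed differently; the solver treats these as
-- variables.
norm≡∥entries∥₁ : ∀ A → norm A ≡ ∥ entries A ∥₁
norm≡∥entries∥₁ A = prove (Vec.map ∣_∣ (entries A))
  (Vector.foldr _:+_ (con 0) λ i → Vector.foldr _:+_ (con 0) (toMatrix x̂ i))
  (Vec.foldr′ _:+_ (con 0) x̂)
  refl
  where
  open ℕSolver.+-*-Solver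
  x̂ = Vec.map var (Vec.allFin 9)

-- A decidable criterion.

-- Horner form of r³ - e₁ r² + e₂ r - e₃ = 0.
Root : ℤ → ℤ → ℤ → ℤ → Set
Root e₁ e₂ e₃ r = r ℤ.* q₀ e₁ e₂ r ≡ e₃

infixl 7 _·ᴹ_
_·ᴹ_ : Vec ℤ 3 → Matrix 3 → Vec ℤ 3
v ·ᴹ B = Vec.tabulate λ j → sum λ l → Vec.lookup v l ℤ.* B l j

-- The auxiliary function shares v ·ᴹ B during evaluation.
krylov : Vec ℤ 3 → Matrix 3 → Vec ℤ 9
krylov v B = go (v ·ᴹ B)
  where
  go : Vec ℤ 3 → Vec ℤ 9
  go w = v Vec.++ w Vec.++ w ·ᴹ B

-- The determinant of the rows v, vB, vB² is 1. Replacing v by -v changes its sign, so the value -1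
-- need not be tried separately.
Cyclic : Matrix 3 → Vec ℤ 3 → Set
Cyclic B v = e₃ (krylov v B) ≡ 1ℤ

-- Abstracting over v and w keeps the type checker from expanding the products.
commute-rows⇒frobeniusType :
  ∀ {A B} → Commute A B → ∀ u v w → v ≡ u ·ᴹ B → w ≡ v ·ᴹ B →
  e₃ (u Vec.++ v Vec.++ w) ≡ 1ℤ → A ∈ FrobeniusType
commute-rows⇒frobeniusType {A} {B} AB≈BA
  u@(_ ∷ _ ∷ _ ∷ []) v@(_ ∷ _ ∷ _ ∷ []) w@(_ ∷ _ ∷ _ ∷ []) v≡uB w≡vB det≡1 =
  cyclic-row⇒frobeniusType {A} {B} {X} AB≈BA (trans (det≡e₃ X) det≡1)
    (∀-cons (at 0F v≡uB) (∀-cons (at 1F v≡uB) (∀-cons (at 2F v≡uB) λ ())))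
    (∀-cons (at 0F w≡vB) (∀-cons (at 1F w≡vB) (∀-cons (at 2F w≡vB) λ ())))
  where
  X = toMatrix (u Vec.++ v Vec.++ w)

  at : ∀ {x y : Vec ℤ 3} j → x ≡ y → Vec.lookup x j ≡ Vec.lookup y j
  at j = cong (λ x → Vec.lookup x j)

commute-cyclic⇒frobeniusType : ∀ {A B} → Commute A B → ∀ v → Cyclic B v → A ∈ FrobeniusType
commute-cyclic⇒frobeniusType {A} {B} AB≈BA v =
  commute-rows⇒frobeniusType {A} {B} AB≈BA v (v ·ᴹ B) (v ·ᴹ B ·ᴹ B) refl refl

-- Rounding down may spoil commutation with A, which is therefore checked below.
halves : Matrix 3 → List (Vec ℤ 9)
halves A = List.map
  (λ p → entries λ i j → ((A *ᴹ A) i j ℤ.+ p ℤ.* A i j) /ℕ 2)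
  (interval 1)

-- The bound 6 suffices: an eigenvalue never exceeds the norm of the matrix in absolute value.
HasRoot : ℤ → ℤ → ℤ → Set
HasRoot e₁ e₂ e₃ = Any (Root e₁ e₂ e₃) (interval 6)

-- If (A² + pA + q) / 2 is integral, then the commutant of A is larger than ℤ[A],
-- so that no v is cyclic for A itself.  The alternatives are ordered by cost.
HasCyclic : Matrix 3 → Set
HasCyclic A =
  Any (Cyclic A) (ball 3 1 ++ ball 3 2) ⊎
  Any (λ ys → Commute A (toMatrix ys) × Any (Cyclic (toMatrix ys)) (ball 3 1)) (halves A) ⊎
  Any (Cyclic A) (ball 3 4)

RootOrCyclic : Vec ℤ 9 → Set
RootOrCyclic xs = HasRoot (e₁ xs) (e₂ xs) (e₃ xs) ⊎ HasCyclic (toMatrix xs)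

hasRoot? : ∀ e₁ e₂ e₃ → Dec (HasRoot e₁ e₂ e₃)
hasRoot? e₁ e₂ e₃ = any? (λ r → r ℤ.* q₀ e₁ e₂ r ℤₚ.≟ e₃) (interval 6)

commute? : (A B : Matrix 3) → Dec (Commute A B)
commute? A B = Finₚ.all? λ i → Finₚ.all? λ j → (A *ᴹ B) i j ℤₚ.≟ (B *ᴹ A) i j

cyclic? : ∀ B → Decidable (Cyclic B)
cyclic? B v = e₃ (krylov v B) ℤₚ.≟ 1ℤ

hasCyclic? : ∀ A → Dec (HasCyclic A)
hasCyclic? A =
  any? (cyclic? A) (ball 3 1 ++ ball 3 2) ⊎-dec
  any? (λ ys → commute? A (toMatrix ys) ×-dec any? (cyclic? (toMatrix ys)) (ball 3 1)) (halves A) ⊎-dec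
  any? (cyclic? A) (ball 3 4)

rootOrCyclic? : ∀ xs → Dec (RootOrCyclic xs)
rootOrCyclic? xs = hasRoot? (e₁ xs) (e₂ xs) (e₃ xs) ⊎-dec hasCyclic? (toMatrix xs)

-- The evaluated matrix agrees with `A` only pointwise, so commutation is transported along
-- `toMatrix-entries`.
hasCyclic⇒frobeniusType : ∀ A → HasCyclic (toMatrix (entries A)) → A ∈ FrobeniusType
hasCyclic⇒frobeniusType A = λ where
    (inj₁ cyclic)              → frobeniusType A′ (λ i j → refl) (Any.satisfied cyclic)
    (inj₂ (inj₁ cyclicHalves)) →
      let ys , A′B≈BA′ , cyclic = Any.satisfied cyclicHalves
      in frobeniusType (toMatrix ys) A′B≈BA′ (Any.satisfied cyclic)
    (inj₂ (inj₂ cyclic))       → frobeniusType A′ (λ i j → refl) (Any.satisfied cyclic)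
  where
  A′ = toMatrix (entries A)

  frobeniusType : ∀ B → Commute A′ B → ∃ (Cyclic B) → A ∈ FrobeniusType
  frobeniusType B A′B≈BA′ (v , cyclic) = commute-cyclic⇒frobeniusType {A} {B}
    (Commute-cong {A = A′} {B = B} (toMatrix-entries A) (λ i j → refl) A′B≈BA′) v cyclic

rootOrCyclic⇒frobeniusType : ∀ A → A ∈ M 3 → RootOrCyclic (entries A) → A ∈ FrobeniusType
rootOrCyclic⇒frobeniusType A A∈M (inj₁ hasRoot) =
  let r , root = Any.satisfied hasRoot
  in contradiction A∈M (root⇒reducible A r root)
rootOrCyclic⇒frobeniusType A A∈M (inj₂ hasCyclic) = hasCyclic⇒frobeniusType A hasCyclic

-- The finite check and the conclusion.

abstract
  ball-rootOrCyclic : All RootOrCyclic (ball 9 6)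
  -- The Boolean test evaluates to `true` on the whole ball, so the type of `_` is the unit type.
  ball-rootOrCyclic = All.map toWitness (all⁺ (isYes ∘ rootOrCyclic?) (ball 9 6) _)

theorem1 : (A : Matrix 3) → A ∈ M 3 → norm A ≤ 6 → A ∈ FrobeniusType
theorem1 A A∈M normA≤6 = rootOrCyclic⇒frobeniusType A A∈M
  (All.lookup ball-rootOrCyclic (∈-ball 6 (entries A)
    (ℕₚ.≤-trans (ℕₚ.≤-reflexive (sym (norm≡∥entries∥₁ A))) normA≤6)))
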